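{- Let $A$ be an algebra in a semidegenerate congruence modular variety such that $K(A)$ is closed under the commutator. If the map $B(Con(A))\rightarrow Clop(Spec(A))$, $\alpha\mapsto D_A(\alpha)$, is a Boolean isomorphism, then the reticulation of $A$ preserves the Boolean center.
   Context: $\mathcal{V}$ is a congruence modular, semidegenerate variety (no nontrivial algebra has a one-element subalgebra; equivalently $\nabla_A$ is compact) of finite signature; $A\in\mathcal{V}$. $Con(A)$ is the congruence lattice with bounds $\Delta_A,\nabla_A$, $[\cdot,\cdot]$ the Freese–McKenzie commutator, $K(A)$ the compact congruences. A congruence $\phi\neq\nabla_A$ is prime if $[\alpha,\beta]\subseteq\phi$ implies $\alpha\subseteq\phi$ or $\beta\subseteq\phi$; $Spec(A)$ is the set of primes; $\rho(\theta)$ is the intersection of primes containing $\theta$; $V_A(\theta)=\{\phi\in Spec(A):\theta\subseteq\phi\}$, $D_A(\theta)=Spec(A)\setminus V_A(\theta)$, and the sets $D_A(\theta)$ form the topology on $Spec(A)$. $Clop(X)$ is the Boolean algebra of clopen subsets of $X$. $B(Con(A))$ is the Boolean algebra of complemented elements of $Con(A)$; for $\alpha\in B(Con(A))$, $D_A(\alpha)$ is clopen. The reticulation $L(A)=K(A)/{\equiv}$ ($\alpha\equiv\beta$ iff $\rho(\alpha)=\rho(\beta)$) is a bounded distributive lattice with canonical map $\lambda_A:K(A)\to L(A)$, which maps $B(Con(A))$ injectively into $B(L(A))$ (complemented elements of $L(A)$). The reticulation of $A$ preserves the Boolean center if $\lambda_A|_{B(Con(A))}:B(Con(A))\to B(L(A))$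 is surjective. -}

module Defs where

open import Data.Empty using (⊥-elim)
open import Data.Fin.Base using (Fin; zero; suc)
open import Data.List.Base using (List; []; _∷_; _++_; map; foldr)
open import Data.Maybe.Base using (Maybe; just; nothing)
open import Data.Nat.Base using (ℕ; zero; suc)
open import Data.Product.Base using (Σ; ∃-syntax; Σ-syntax; _×_; _,_; proj₁; proj₂)
open import Data.Sum.Base using (_⊎_; inj₁; inj₂; [_,_])
open import Data.Unit.Polymorphic.Base using (⊤; tt)
open import Function.Base using (_∘_; _on_)
open import Function.Definitions using (Congruent; Bijective; Surjective)
open import Level using (Level; _⊔_) renaming (suc to lsuc)
open import Relation.Binary.Core using (Rel; _⇒_; _⇔_)
open import Relation.Binary.Lattice.Bundles using (BoundedLattice; BooleanAlgebra)
open import Relation.Binary.Structures using (IsEquivalence)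
open import Relation.Nullary.Decidable.Core using (yes; no; ¬?; _×-dec_; _⊎-dec_)
open import Relation.Nullary.Negation.Core using (¬_)
open import Relation.Unary using (Pred; Decidable; ∁; _≐_; _∪_; _∩_) renaming (_⊆_ to _⊆ᵖ_)

module _ {c ℓ₁ ℓ₂} (L : BoundedLattice c ℓ₁ ℓ₂) where
  open BoundedLattice L

  Modular : Set (c ⊔ ℓ₁ ⊔ ℓ₂)
  Modular = ∀ x y z → x ≤ z → x ∨ (y ∧ z) ≈ (x ∨ y) ∧ z

  IsComplement : Rel Carrier ℓ₁
  IsComplement x y = (x ∧ y ≈ BoundedLattice.⊥ L) × (x ∨ y ≈ BoundedLattice.⊤ L)

  Complemented : Pred Carrier (c ⊔ ℓ₁)
  Complemented x = ∃[ y ] IsComplement x y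

  BooleanCenter : Set (c ⊔ ℓ₁)
  BooleanCenter = Σ Carrier Complemented

  _≈ᴮ_ : Rel BooleanCenter ℓ₁
  _≈ᴮ_ = _≈_ on proj₁

-- The operations of the Boolean algebra B(L) are those of L, so they are
-- treated as relations on B(L): e.g. "c is the meet of a and b in L", for
-- a, b, c ∈ B(L).  This avoids having to prove first that B(L) is closed
-- under ∧ and ∨ (which fails for an arbitrary L).
module _ {c ℓ₁ ℓ₂ c′ ℓ₁′ ℓ₂′}
         (L : BoundedLattice c ℓ₁ ℓ₂) (M : BooleanAlgebra c′ ℓ₁′ ℓ₂′) where
  private
    module L = BoundedLattice L
    module M = BooleanAlgebra M

  record IsBooleanIsomorphism (f : BooleanCenter L → M.Carrier)
         : Set (c ⊔ ℓ₁ ⊔ c′ ⊔ ℓ₁′) where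
    field
      cong      : Congruent (_≈ᴮ_ L) M._≈_ f
      bijective : Bijective (_≈ᴮ_ L) M._≈_ f
      ∧-homo    : ∀ a b c → proj₁ c L.≈ (proj₁ a L.∧ proj₁ b) → f c M.≈ (f a M.∧ f b)
      ∨-homo    : ∀ a b c → proj₁ c L.≈ (proj₁ a L.∨ proj₁ b) → f c M.≈ (f a M.∨ f b)
      ¬-homo    : ∀ a b → IsComplement L (proj₁ a) (proj₁ b) → f b M.≈ (M.¬ f a)
      ⊤-homo    : ∀ a → proj₁ a L.≈ L.⊤ → f a M.≈ M.⊤
      ⊥-homo    : ∀ a → proj₁ a L.≈ L.⊥ → f a M.≈ M.⊥

record Signature : Set where
  field
    #ops  : ℕ
    arity : Fin #ops → ℕ

  Op : Set
  Op = Fin #ops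

module _ (S : Signature) where
  open Signature S

  data Term (X : Set) : Set where
    var  : X → Term X
    node : (f : Op) → (Fin (arity f) → Term X) → Term X

  -- Algebras are setoid-based, so that quotients exist, and nonempty.
  record Algebra (ℓ : Level) : Set (lsuc ℓ) where
    infix 4 _≈_
    field
      Carrier       : Set ℓ
      _≈_           : Rel Carrier ℓ
      isEquivalence : IsEquivalence _≈_
      op            : (f : Op) → (Fin (arity f) → Carrier) → Carrier
      op-cong       : ∀ f {as bs} → (∀ i → as i ≈ bs i) → op f as ≈ op f bs
      point         : Carrier

    eval : {X : Set} → (X → Carrier) → Term X → Carrier
    eval ρ (var x)     = ρ x
    eval ρ (node f ts) = op f (λ i → eval ρ (ts i))

  -- A variety is given by a set of equations.
  Variety : (e : Level) → Set (lsuc e)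
  Variety e = Rel (Term ℕ) e

module _ {S : Signature} where

  infix 4 _∈ⱽ_
  _∈ⱽ_ : ∀ {ℓ e} → Algebra S ℓ → Variety S e → Set (ℓ ⊔ e)
  A ∈ⱽ 𝒱 = ∀ s t → 𝒱 s t → (ρ : ℕ → Carrier) → eval ρ s ≈ eval ρ t
    where open Algebra A

module Congruences {S : Signature} {ℓ : Level} (A : Algebra S ℓ) where
  open Signature S
  open Algebra A
  private module E = IsEquivalence isEquivalence

  IsSubuniverse : ∀ {κ} → Pred Carrier κ → Set (ℓ ⊔ κ)
  IsSubuniverse P = ∀ f as → (∀ i → P (as i)) → P (op f as)

  IsTrivial : Set ℓ
  IsTrivial = ∀ x y → x ≈ y

  record IsCongruence {κ} (_∼_ : Rel Carrier κ) : Set (ℓ ⊔ κ) where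
    field
      reflexive : ∀ {x y} → x ≈ y → x ∼ y
      sym       : ∀ {x y} → x ∼ y → y ∼ x
      trans     : ∀ {x y z} → x ∼ y → y ∼ z → x ∼ z
      compat    : ∀ f {as bs} → (∀ i → as i ∼ bs i) → op f as ∼ op f bs

  record Congruence (κ : Level) : Set (ℓ ⊔ lsuc κ) where
    field
      rel          : Rel Carrier κ
      isCongruence : IsCongruence rel
    open IsCongruence isCongruence public

  open Congruence public using (rel)

  infix 4 _⊆_
  _⊆_ : ∀ {κ κ′} → Congruence κ → Congruence κ′ → Set (ℓ ⊔ κ ⊔ κ′)
  α ⊆ β = rel α ⇒ rel β

  Δ : Congruence ℓ
  Δ = record
    { rel = _≈_
    ; isCongruence = record
      { reflexive = λ p → p ; sym = E.sym ; trans = E.trans ; compat = op-cong } }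

  ∇ : Congruence ℓ
  ∇ = record
    { rel = λ _ _ → ⊤
    ; isCongruence = record
      { reflexive = λ _ → tt ; sym = λ _ → tt
      ; trans = λ _ _ → tt ; compat = λ _ _ → tt } }

  infixr 7 _∧_
  _∧_ : Congruence ℓ → Congruence ℓ → Congruence ℓ
  α ∧ β = record
    { rel = λ x y → rel α x y × rel β x y
    ; isCongruence = record
      { reflexive = λ p → α.reflexive p , β.reflexive p
      ; sym       = λ (p , q) → α.sym p , β.sym q
      ; trans     = λ (p , q) (p′ , q′) → α.trans p p′ , β.trans q q′
      ; compat    = λ f h → α.compat f (proj₁ ∘ h) , β.compat f (proj₂ ∘ h) } }
    where
      module α = Congruence α
      module β = Congruence β

  data Generated (R : Rel Carrier ℓ) : Rel Carrier ℓ where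
    base   : ∀ {x y} → R x y → Generated R x y
    refl   : ∀ {x y} → x ≈ y → Generated R x y
    sym    : ∀ {x y} → Generated R x y → Generated R y x
    trans  : ∀ {x y z} → Generated R x y → Generated R y z → Generated R x z
    compat : ∀ f {as bs} → (∀ i → Generated R (as i) (bs i)) →
             Generated R (op f as) (op f bs)

  Cg : Rel Carrier ℓ → Congruence ℓ
  Cg R = record
    { rel = Generated R
    ; isCongruence = record { reflexive = refl ; sym = sym ; trans = trans ; compat = compat } }

  Cg-least : ∀ {R} (θ : Congruence ℓ) → R ⇒ rel θ → Cg R ⊆ θ
  Cg-least {R} θ h = go
    where
      module θ = Congruence θ
      go : Generated R ⇒ rel θ
      go (base r)     = h r
      go (refl p)     = θ.reflexive p
      go (sym p)      = θ.sym (go p)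
      go (trans p q)  = θ.trans (go p) (go q)
      go (compat f k) = θ.compat f (λ i → go (k i))

  infixr 6 _∨_
  _∨_ : Congruence ℓ → Congruence ℓ → Congruence ℓ
  α ∨ β = Cg (λ x y → rel α x y ⊎ rel β x y)

  ∨-least : ∀ α β θ → α ⊆ θ → β ⊆ θ → (α ∨ β) ⊆ θ
  ∨-least α β θ p q = Cg-least θ [ p , q ]

  ⋁ : {I : Set ℓ} → (I → Congruence ℓ) → Congruence ℓ
  ⋁ {I} θ = Cg (λ x y → Σ[ i ∈ I ] rel (θ i) x y)

  ⋁-fin : {I : Set ℓ} → (I → Congruence ℓ) → List I → Congruence ℓ
  ⋁-fin θ is = foldr _∨_ Δ (map θ is)

  Con : BoundedLattice (lsuc ℓ) ℓ ℓ
  Con = record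
    { Carrier = Congruence ℓ
    ; _≈_     = λ α β → rel α ⇔ rel β
    ; _≤_     = _⊆_
    ; _∨_     = _∨_
    ; _∧_     = _∧_
    ; ⊤       = ∇
    ; ⊥       = Δ
    ; isBoundedLattice = record
      { isLattice = record
        { isPartialOrder = record
          { isPreorder = record
            { isEquivalence = record
              { refl  = (λ p → p) , (λ p → p)
              ; sym   = λ (p , q) → (λ r → q r) , (λ r → p r)
              ; trans = λ (p , q) (p′ , q′) → (λ r → p′ (p r)) , (λ r → q (q′ r)) }
            ; reflexive = λ (p , _) → p
            ; trans     = λ p q r → q (p r) }
          ; antisym = λ p q → (λ r → p r) , (λ r → q r) }
        ; supremum = λ α β → (λ p → base (inj₁ p)) , (λ p → base (inj₂ p)) ,
                             λ θ p q → ∨-least α β θ p q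
        ; infimum  = λ α β → proj₁ , proj₂ , λ θ p q r → p r , q r }
      ; maximum = λ _ _ → tt
      ; minimum = λ α p → Congruence.reflexive α p } }

  Compact : Pred (Congruence ℓ) (lsuc ℓ)
  Compact α = ∀ {I : Set ℓ} (θ : I → Congruence ℓ) → α ⊆ ⋁ θ → ∃[ is ] α ⊆ ⋁-fin θ is

  K : Set (lsuc ℓ)
  K = Σ (Congruence ℓ) Compact

  -- C(α,β;δ), the term condition.
  Centralizes : (α β δ : Congruence ℓ) → Set ℓ
  Centralizes α β δ =
    ∀ {n m} (t : Term S (Fin n ⊎ Fin m)) {a b : Fin n → Carrier} {u v : Fin m → Carrier} →
    (∀ i → rel α (a i) (b i)) → (∀ j → rel β (u j) (v j)) →
    rel δ (eval [ a , u ] t) (eval [ a , v ] t) →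
    rel δ (eval [ b , u ] t) (eval [ b , v ] t)

  -- [α,β] is the least δ with C(α,β;δ).  As C(α,β;-) is a closure condition,
  -- this δ is generated inductively; commutator-centralizes and
  -- commutator-least are its defining properties.
  data Commutator (α β : Congruence ℓ) : Rel Carrier ℓ where
    refl   : ∀ {x y} → x ≈ y → Commutator α β x y
    sym    : ∀ {x y} → Commutator α β x y → Commutator α β y x
    trans  : ∀ {x y z} → Commutator α β x y → Commutator α β y z → Commutator α β x z
    compat : ∀ f {as bs} → (∀ i → Commutator α β (as i) (bs i)) →
             Commutator α β (op f as) (op f bs)
    centr  : ∀ {n m} (t : Term S (Fin n ⊎ Fin m))
             {a b : Fin n → Carrier} {u v : Fin m → Carrier} →
             (∀ i → rel α (a i) (b i)) → (∀ j → rel β (u j) (v j)) →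
             Commutator α β (eval [ a , u ] t) (eval [ a , v ] t) →
             Commutator α β (eval [ b , u ] t) (eval [ b , v ] t)

  [_⨾_] : Congruence ℓ → Congruence ℓ → Congruence ℓ
  [ α ⨾ β ] = record
    { rel = Commutator α β
    ; isCongruence = record { reflexive = refl ; sym = sym ; trans = trans ; compat = compat } }

  commutator-centralizes : ∀ α β → Centralizes α β [ α ⨾ β ]
  commutator-centralizes α β = centr

  commutator-least : ∀ α β δ → Centralizes α β δ → [ α ⨾ β ] ⊆ δ
  commutator-least α β δ C = go
    where
      module δ = Congruence δ
      go : Commutator α β ⇒ rel δ
      go (refl p)        = δ.reflexive p
      go (sym p)         = δ.sym (go p)
      go (trans p q)     = δ.trans (go p) (go q)
      go (compat f k)    = δ.compat f (λ i → go (k i))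
      go (centr t p q r) = C t p q (go r)

  eval-rel : ∀ (θ : Congruence ℓ) {X : Set} (t : Term S X) {a b : X → Carrier} →
             (∀ x → rel θ (a x) (b x)) → rel θ (eval a t) (eval b t)
  eval-rel θ (var x)     h = h x
  eval-rel θ (node f ts) h = Congruence.compat θ f (λ i → eval-rel θ (ts i) h)

  commutator-⊆ˡ : ∀ α β → [ α ⨾ β ] ⊆ α
  commutator-⊆ˡ α β = commutator-least α β α
    λ t p q r → α.trans (α.sym (step t p)) (α.trans r (step t p))
    where
      module α = Congruence α
      step : ∀ {n m} (t : Term S (Fin n ⊎ Fin m)) {a b : Fin n → Carrier} {w : Fin m → Carrier} →
             (∀ i → rel α (a i) (b i)) → rel α (eval [ a , w ] t) (eval [ b , w ] t)
      step t p = eval-rel α t λ { (inj₁ i) → p i ; (inj₂ j) → α.reflexive E.refl }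

  commutator-⊆ʳ : ∀ α β → [ α ⨾ β ] ⊆ β
  commutator-⊆ʳ α β = commutator-least α β β
    λ t p q r → eval-rel β t λ { (inj₁ i) → Congruence.reflexive β E.refl ; (inj₂ j) → q j }

  CommutatorClosed : Set (lsuc ℓ)
  CommutatorClosed = ∀ α β → Compact α → Compact β → Compact [ α ⨾ β ]

  record IsPrime (φ : Congruence ℓ) : Set (lsuc ℓ) where
    field
      proper : ¬ (rel φ ⇔ rel ∇)
      prime  : ∀ α β → [ α ⨾ β ] ⊆ φ → (α ⊆ φ) ⊎ (β ⊆ φ)

  Spec : Set (lsuc ℓ)
  Spec = Σ (Congruence ℓ) IsPrime

  V : Congruence ℓ → Pred Spec ℓ
  V θ (φ , _) = θ ⊆ φ

  D : Congruence ℓ → Pred Spec ℓ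
  D θ = ∁ (V θ)

  IsOpen : Pred Spec ℓ → Set (lsuc ℓ)
  IsOpen U = ∃[ θ ] U ≐ D θ

  -- Decidability is the law U ∪ ∁ U = Spec, automatic classically; it is what
  -- makes the clopen sets a Boolean algebra.
  record IsClopen (U : Pred Spec ℓ) : Set (lsuc ℓ) where
    field
      isOpen    : IsOpen U
      isClosed  : IsOpen (∁ U)
      decidable : Decidable U

  -- A congruence, although one universe up since Spec is large.
  ρ : Congruence ℓ → Congruence (lsuc ℓ)
  ρ θ = record
    { rel = λ x y → (φ : Spec) → V θ φ → rel (proj₁ φ) x y
    ; isCongruence = record
      { reflexive = λ p φ _ → Congruence.reflexive (proj₁ φ) p
      ; sym       = λ p φ h → Congruence.sym (proj₁ φ) (p φ h)
      ; trans     = λ p q φ h → Congruence.trans (proj₁ φ) (p φ h) (q φ h)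
      ; compat    = λ f k φ h → Congruence.compat (proj₁ φ) f (λ i → k i φ h) } }

  D-∇ : ∀ φ → D ∇ φ
  D-∇ (φ , π) h = IsPrime.proper π ((λ _ → tt) , λ _ → h tt)

  D-Δ : ∀ φ → ¬ D Δ φ
  D-Δ (φ , _) h = h (Congruence.reflexive φ)

  D-commutator : ∀ α β → (D α ∩ D β) ≐ D [ α ⨾ β ]
  D-commutator α β =
    (λ {(_ , π)} (p , q) h → [ p , q ] (IsPrime.prime π α β h)) ,
    (λ n → (λ h → n (λ r → h (commutator-⊆ˡ α β r))) , (λ h → n (λ r → h (commutator-⊆ʳ α β r))))

  private
    ≐-isOpen : ∀ {U W} → U ≐ W → IsOpen W → IsOpen U
    ≐-isOpen (p , q) (θ , r , s) = θ , (λ x → r (p x)) , (λ x → q (s x))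

    ∩-isOpen : ∀ {U W} → IsOpen U → IsOpen W → IsOpen (U ∩ W)
    ∩-isOpen (θ , p , q) (η , p′ , q′) =
      [ θ ⨾ η ] ,
      (λ {φ} (u , w) → proj₁ (D-commutator θ η) {φ} (p u , p′ w)) ,
      (λ {φ} d → let (a , b) = proj₂ (D-commutator θ η) {φ} d in q a , q′ b)

    ∪-isOpen : ∀ {U W} → Decidable U → Decidable W → IsOpen U → IsOpen W → IsOpen (U ∪ W)
    ∪-isOpen {U} {W} U? W? (θ , p , q) (η , p′ , q′) = (θ ∨ η) , to , from
      where
        to : (U ∪ W) ⊆ᵖ D (θ ∨ η)
        to (inj₁ u) h = p u (λ r → h (base (inj₁ r)))
        to (inj₂ w) h = p′ w (λ r → h (base (inj₂ r)))

        from : D (θ ∨ η) ⊆ᵖ (U ∪ W)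
        from {φ} d with U? φ | W? φ
        ... | yes u | _     = inj₁ u
        ... | no  _ | yes w = inj₂ w
        ... | no ¬u | no ¬w =
          ⊥-elim (¬u (q λ h → ¬w (q′ λ h′ → d (∨-least θ η (proj₁ φ) h h′))))

    deMorgan-∪ : ∀ {U W : Pred Spec ℓ} → ∁ (U ∪ W) ≐ (∁ U ∩ ∁ W)
    deMorgan-∪ = (λ n → (λ u → n (inj₁ u)) , (λ w → n (inj₂ w))) , (λ (m , n) → [ m , n ])

    deMorgan-∩ : ∀ {U W : Pred Spec ℓ} → Decidable U → ∁ (U ∩ W) ≐ (∁ U ∪ ∁ W)
    deMorgan-∩ {U} {W} U? = to , [ (λ m (u , _) → m u) , (λ m (_ , w) → m w) ]
      where
        to : ∁ (U ∩ W) ⊆ᵖ (∁ U ∪ ∁ W)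
        to {φ} n with U? φ
        ... | yes u = inj₂ (λ w → n (u , w))
        ... | no ¬u = inj₁ ¬u

    stable : ∀ {U : Pred Spec ℓ} → Decidable U → ∁ (∁ U) ≐ U
    stable {U} U? = to , (λ u n → n u)
      where
        to : ∁ (∁ U) ⊆ᵖ U
        to {φ} nn with U? φ
        ... | yes u = u
        ... | no ¬u = ⊥-elim (nn ¬u)

    ∁? : ∀ {U : Pred Spec ℓ} → Decidable U → Decidable (∁ U)
    ∁? U? φ = ¬? (U? φ)

    clopen-∪ : ∀ {U W} → IsClopen U → IsClopen W → IsClopen (U ∪ W)
    clopen-∪ c d = record
      { isOpen    = ∪-isOpen C.decidable D.decidable C.isOpen D.isOpen
      ; isClosed  = ≐-isOpen deMorgan-∪ (∩-isOpen C.isClosed D.isClosed)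
      ; decidable = λ φ → C.decidable φ ⊎-dec D.decidable φ }
      where
        module C = IsClopen c
        module D = IsClopen d

    clopen-∩ : ∀ {U W} → IsClopen U → IsClopen W → IsClopen (U ∩ W)
    clopen-∩ c d = record
      { isOpen    = ∩-isOpen C.isOpen D.isOpen
      ; isClosed  = ≐-isOpen (deMorgan-∩ C.decidable)
                      (∪-isOpen (∁? C.decidable) (∁? D.decidable) C.isClosed D.isClosed)
      ; decidable = λ φ → C.decidable φ ×-dec D.decidable φ }
      where
        module C = IsClopen c
        module D = IsClopen d

    clopen-∁ : ∀ {U} → IsClopen U → IsClopen (∁ U)
    clopen-∁ c = record
      { isOpen    = C.isClosed
      ; isClosed  = ≐-isOpen (stable C.decidable) C.isOpen
      ; decidable = ∁? C.decidable }
      where module C = IsClopen c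

    Spec-all : Pred Spec ℓ
    Spec-all _ = ⊤

    clopen-all : IsClopen Spec-all
    clopen-all = record
      { isOpen    = ∇ , (λ {φ} _ → D-∇ φ) , (λ _ → tt)
      ; isClosed  = Δ , (λ n → ⊥-elim (n tt)) , (λ {φ} d _ → D-Δ φ d)
      ; decidable = λ _ → yes tt }

  D-clopen : ∀ α → Complemented Con α → IsClopen (D α)
  D-clopen α (α′ , (α∧α′⊆Δ , _) , (_ , ∇⊆α∨α′)) = record
    { isOpen    = α , (λ d → d) , (λ d → d)
    ; isClosed  = α′ , (λ {φ} n → to {φ} n) , (λ {φ} n d → [ d , n ] (dichotomy φ))
    ; decidable = dec }
    where
      dichotomy : ∀ φ → V α φ ⊎ V α′ φ
      dichotomy (φ , π) = IsPrime.prime π α α′ λ r →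
        Congruence.reflexive φ (α∧α′⊆Δ (commutator-⊆ˡ α α′ r , commutator-⊆ʳ α α′ r))

      exclusive : ∀ φ → V α φ → D α′ φ
      exclusive φ p q = D-∇ φ (λ r → ∨-least α α′ (proj₁ φ) p q (∇⊆α∨α′ r))

      to : ∁ (D α) ⊆ᵖ D α′
      to {φ} n q = n (λ p → exclusive φ p q)

      dec : Decidable (D α)
      dec φ with dichotomy φ
      ... | inj₁ p = no (λ d → d p)
      ... | inj₂ q = yes (λ p → exclusive φ p q)

  Clop : BooleanAlgebra (lsuc ℓ) (lsuc ℓ) (lsuc ℓ)
  Clop = record
    { Carrier = Σ (Pred Spec ℓ) IsClopen
    ; _≈_     = λ U W → proj₁ U ≐ proj₁ W
    ; _≤_     = λ U W → proj₁ U ⊆ᵖ proj₁ W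
    ; _∨_     = λ (U , c) (W , d) → (U ∪ W) , clopen-∪ c d
    ; _∧_     = λ (U , c) (W , d) → (U ∩ W) , clopen-∩ c d
    ; ¬_      = λ (U , c) → ∁ U , clopen-∁ c
    ; ⊤       = Spec-all , clopen-all
    ; ⊥       = ∁ Spec-all , clopen-∁ clopen-all
    ; isBooleanAlgebra = record
      { isHeytingAlgebra = record
        { isBoundedLattice = record
          { isLattice = record
            { isPartialOrder = record
              { isPreorder = record
                { isEquivalence = record
                  { refl  = (λ p → p) , (λ p → p)
                  ; sym   = λ (p , q) → (λ r → q r) , (λ r → p r)
                  ; trans = λ (p , q) (p′ , q′) → (λ r → p′ (p r)) , (λ r → q (q′ r)) }
                ; reflexive = λ (p , _) → p
                ; trans     = λ p q r → q (p r) }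
              ; antisym = λ p q → (λ r → p r) , (λ r → q r) }
            ; supremum = λ U W → inj₁ , inj₂ , λ Z p q → [ (λ r → p r) , (λ r → q r) ]
            ; infimum  = λ U W → proj₁ , proj₂ , λ Z p q r → p r , q r }
          ; maximum = λ U _ → tt
          ; minimum = λ U n → ⊥-elim (n tt) }
        ; exponential = λ Z U W →
            (λ h {φ} z → implies (proj₂ U) h φ z) ,
            (λ h {φ} (z , u) → [ (λ n → ⊥-elim (n u)) , (λ w → w) ] (h z)) } } }
    where
      implies : ∀ {Z U W : Pred Spec ℓ} → IsClopen U → (Z ∩ U) ⊆ᵖ W → ∀ φ → Z φ → (∁ U ∪ W) φ
      implies c h φ z with IsClopen.decidable c φ
      ... | yes u = inj₂ (h (z , u))
      ... | no ¬u = inj₁ ¬u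

  D-map : BooleanCenter Con → BooleanAlgebra.Carrier Clop
  D-map (α , c) = D α , D-clopen α c

  ⋁-fin-least : ∀ {I : Set ℓ} (θ : I → Congruence ℓ) is (η : Congruence ℓ) →
                (∀ i → θ i ⊆ η) → ⋁-fin θ is ⊆ η
  ⋁-fin-least θ []       η h = Congruence.reflexive η
  ⋁-fin-least θ (i ∷ is) η h = ∨-least (θ i) (⋁-fin θ is) η (h i) (⋁-fin-least θ is η h)

  ⋁-fin-++ˡ : ∀ {I : Set ℓ} (θ : I → Congruence ℓ) is js → ⋁-fin θ is ⊆ ⋁-fin θ (is ++ js)
  ⋁-fin-++ˡ θ []       js = Congruence.reflexive (⋁-fin θ js)
  ⋁-fin-++ˡ θ (i ∷ is) js = ∨-least (θ i) (⋁-fin θ is) (⋁-fin θ (i ∷ is ++ js))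
    (λ p → base (inj₁ p)) (λ p → base (inj₂ (⋁-fin-++ˡ θ is js p)))

  ⋁-fin-++ʳ : ∀ {I : Set ℓ} (θ : I → Congruence ℓ) is js → ⋁-fin θ js ⊆ ⋁-fin θ (is ++ js)
  ⋁-fin-++ʳ θ []       js p = p
  ⋁-fin-++ʳ θ (i ∷ is) js p = base (inj₂ (⋁-fin-++ʳ θ is js p))

  finitely-many : ∀ {I : Set ℓ} (θ : I → Congruence ℓ) n {as bs : Fin n → Carrier} →
                  (∀ k → ∃[ is ] rel (⋁-fin θ is) (as k) (bs k)) →
                  ∃[ is ] (∀ k → rel (⋁-fin θ is) (as k) (bs k))
  finitely-many θ zero    h = [] , λ ()
  finitely-many θ (suc n) h =
    let (is , p) = h zero
        (js , q) = finitely-many θ n (h ∘ suc)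
    in is ++ js , λ { zero → ⋁-fin-++ˡ θ is js p ; (suc k) → ⋁-fin-++ʳ θ is js (q k) }

  ⋁-finitary : ∀ {I : Set ℓ} (θ : I → Congruence ℓ) {x y} →
               rel (⋁ θ) x y → ∃[ is ] rel (⋁-fin θ is) x y
  ⋁-finitary θ (base (i , p)) = i ∷ [] , base (inj₁ p)
  ⋁-finitary θ (refl p)       = [] , p
  ⋁-finitary θ (sym p)        =
    let (is , q) = ⋁-finitary θ p in is , Congruence.sym (⋁-fin θ is) q
  ⋁-finitary θ (trans p q)    =
    let (is , p′) = ⋁-finitary θ p
        (js , q′) = ⋁-finitary θ q
    in is ++ js , Congruence.trans (⋁-fin θ (is ++ js))
                    (⋁-fin-++ˡ θ is js p′) (⋁-fin-++ʳ θ is js q′)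
  ⋁-finitary θ (compat f k)   =
    let (is , q) = finitely-many θ (arity f) (λ i → ⋁-finitary θ (k i))
    in is , Congruence.compat (⋁-fin θ is) f q

  Δ-compact : Compact Δ
  Δ-compact θ _ = [] , λ p → p

  ∨-compact : ∀ α β → Compact α → Compact β → Compact (α ∨ β)
  ∨-compact α β c d θ h =
    let (is , p) = c θ (λ r → h (base (inj₁ r)))
        (js , q) = d θ (λ r → h (base (inj₂ r)))
    in is ++ js , ∨-least α β (⋁-fin θ (is ++ js))
         (λ r → ⋁-fin-++ˡ θ is js (p r)) (λ r → ⋁-fin-++ʳ θ is js (q r))

  Principal : Carrier → Carrier → Congruence ℓ
  Principal a b = Cg (λ x y → (x ≈ a) × (y ≈ b))

  Pairs : Congruence ℓ → Set ℓ
  Pairs γ = Σ[ x ∈ Carrier ] Σ[ y ∈ Carrier ] rel γ x y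

  principal : ∀ γ → Pairs γ → Congruence ℓ
  principal γ (x , y , _) = Principal x y

  principal-⊆ : ∀ γ p → principal γ p ⊆ γ
  principal-⊆ γ (a , b , r) = Cg-least γ λ (p , q) →
    γ.trans (γ.reflexive p) (γ.trans r (γ.reflexive (E.sym q)))
    where module γ = Congruence γ

  complemented⇒compact : Modular Con → Compact ∇ → ∀ γ → Complemented Con γ → Compact γ
  complemented⇒compact modular ∇-compact γ (δ , (γ∧δ⊆Δ , _) , (_ , ∇⊆γ∨δ)) θ γ⊆⋁θ =
    let (ps , ∇⊆) = ∇-compact family (λ r → ∨-least γ δ (⋁ family) γ⊆ δ⊆ (∇⊆γ∨δ r))
        qs        = justs ps
        μ         = ⋁-fin (principal γ) qs
        μ⊆γ       = ⋁-fin-least (principal γ) qs γ (principal-⊆ γ)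
        (is , μ⊆) = cover qs
    in is , λ r → μ⊆ (∨-least μ (δ ∧ γ) μ (λ p → p)
                        (λ (d , g) → Congruence.reflexive μ (γ∧δ⊆Δ (g , d)))
                        (proj₂ (modular μ δ γ μ⊆γ) (split ps (∇⊆ tt) , r)))
    where
      family : Maybe (Pairs γ) → Congruence ℓ
      family nothing  = δ
      family (just p) = principal γ p

      γ⊆ : γ ⊆ ⋁ family
      γ⊆ r = base (just (_ , _ , r) , base (E.refl , E.refl))

      δ⊆ : δ ⊆ ⋁ family
      δ⊆ r = base (nothing , r)

      justs : List (Maybe (Pairs γ)) → List (Pairs γ)
      justs []             = []
      justs (nothing ∷ ps) = justs ps
      justs (just p ∷ ps)  = p ∷ justs ps

      split : ∀ ps → ⋁-fin family ps ⊆ (⋁-fin (principal γ) (justs ps) ∨ δ)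
      split []             p = base (inj₁ p)
      split (nothing ∷ ps) =
        ∨-least δ (⋁-fin family ps) (⋁-fin (principal γ) (justs ps) ∨ δ)
          (λ p → base (inj₂ p)) (split ps)
      split (just p ∷ ps)  =
        ∨-least (principal γ p) (⋁-fin family ps) (⋁-fin (principal γ) (p ∷ justs ps) ∨ δ)
          (λ r → base (inj₁ (base (inj₁ r))))
          (λ r → ∨-least (⋁-fin (principal γ) (justs ps)) δ (⋁-fin (principal γ) (p ∷ justs ps) ∨ δ)
                   (λ s → base (inj₁ (base (inj₂ s)))) (λ s → base (inj₂ s)) (split ps r))

      cover : ∀ qs → ∃[ is ] ⋁-fin (principal γ) qs ⊆ ⋁-fin θ is
      cover []                 = [] , λ p → p
      cover ((a , b , r) ∷ qs) =
        let (is , p) = ⋁-finitary θ (γ⊆⋁θ r)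
            (js , q) = cover qs
            η        = ⋁-fin θ (is ++ js)
            module η = Congruence η
        in is ++ js , ∨-least (Principal a b) (⋁-fin (principal γ) qs) η
             (Cg-least η λ (s , t) → η.trans (η.reflexive s)
                (η.trans (⋁-fin-++ˡ θ is js p) (η.reflexive (E.sym t))))
             (λ s → ⋁-fin-++ʳ θ is js (q s))

  module Reticulation (∇-compact : Compact ∇) (closed : CommutatorClosed) where

    private
      ρ-mono⁻ : ∀ α β → ρ α ⊆ ρ β → ∀ φ → V β φ → V α φ
      ρ-mono⁻ α β h φ v r = h (λ ψ w → w r) φ v

      ρ-mono : ∀ α β → (∀ φ → V β φ → V α φ) → ρ α ⊆ ρ β
      ρ-mono α β h p φ v = p φ (h φ v)

      meet : ∀ α β θ → ρ θ ⊆ ρ α → ρ θ ⊆ ρ β → ∀ φ → V [ α ⨾ β ] φ → V θ φ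
      meet α β θ p q φ v with IsPrime.prime (proj₂ φ) α β v
      ... | inj₁ a = ρ-mono⁻ θ α p φ a
      ... | inj₂ b = ρ-mono⁻ θ β q φ b

    -- L(A) = K(A)/≡ as a setoid: λ(α) is α itself, λ(α) ∨ λ(β) = λ(α ∨ β)
    -- and λ(α) ∧ λ(β) = λ([α,β]).
    L : BoundedLattice (lsuc ℓ) (lsuc ℓ) (lsuc ℓ)
    L = record
      { Carrier = K
      ; _≈_     = λ (α , _) (β , _) → rel (ρ α) ⇔ rel (ρ β)
      ; _≤_     = λ (α , _) (β , _) → ρ α ⊆ ρ β
      ; _∨_     = λ (α , c) (β , d) → (α ∨ β) , ∨-compact α β c d
      ; _∧_     = λ (α , c) (β , d) → [ α ⨾ β ] , closed α β c d
      ; ⊤       = ∇ , ∇-compact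
      ; ⊥       = Δ , Δ-compact
      ; isBoundedLattice = record
        { isLattice = record
          { isPartialOrder = record
            { isPreorder = record
              { isEquivalence = record
                { refl  = (λ p → p) , (λ p → p)
                ; sym   = λ (p , q) → (λ r → q r) , (λ r → p r)
                ; trans = λ (p , q) (p′ , q′) → (λ r → p′ (p r)) , (λ r → q (q′ r)) }
              ; reflexive = λ (p , _) → p
              ; trans     = λ p q r → q (p r) }
            ; antisym = λ p q → (λ r → p r) , (λ r → q r) }
          ; supremum = λ (α , _) (β , _) →
              ρ-mono α (α ∨ β) (λ φ v r → v (base (inj₁ r))) ,
              ρ-mono β (α ∨ β) (λ φ v r → v (base (inj₂ r))) ,
              λ (θ , _) p q → ρ-mono (α ∨ β) θ λ φ v →
                ∨-least α β (proj₁ φ) (ρ-mono⁻ α θ p φ v) (ρ-mono⁻ β θ q φ v)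
          ; infimum  = λ (α , _) (β , _) →
              ρ-mono [ α ⨾ β ] α (λ φ v r → v (commutator-⊆ˡ α β r)) ,
              ρ-mono [ α ⨾ β ] β (λ φ v r → v (commutator-⊆ʳ α β r)) ,
              λ (θ , _) p q → ρ-mono θ [ α ⨾ β ] (meet α β θ (λ r → p r) (λ r → q r)) }
        ; maximum = λ (α , _) → ρ-mono α ∇ (λ φ v _ → v tt)
        ; minimum = λ (α , _) → ρ-mono Δ α (λ φ _ → Congruence.reflexive (proj₁ φ)) } }

    lam : K → BoundedLattice.Carrier L
    lam α = α

    module _ (modular : Modular Con) where

      lam-B : BooleanCenter Con → BooleanCenter L
      lam-B (α , c@(β , (α∧β⊆Δ , Δ⊆) , (_ , ∇⊆α∨β))) =
        lam (α , complemented⇒compact modular ∇-compact α c) ,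
        lam (β , complemented⇒compact modular ∇-compact β
              (α , ((λ (p , q) → α∧β⊆Δ (q , p)) , λ r → Congruence.reflexive β r , Congruence.reflexive α r)
                 , ((λ _ → tt) , λ r → ∨-least α β (β ∨ α) (λ s → base (inj₂ s)) (λ s → base (inj₁ s)) (∇⊆α∨β r)))) ,
        ( ρ-mono [ α ⨾ β ] Δ (λ φ v r → v (α∧β⊆Δ (commutator-⊆ˡ α β r , commutator-⊆ʳ α β r)))
        , ρ-mono Δ [ α ⨾ β ] (λ φ _ → Congruence.reflexive (proj₁ φ)) ) ,
        ( ρ-mono (α ∨ β) ∇ (λ φ v _ → v tt)
        , ρ-mono ∇ (α ∨ β) (λ φ v r → v (∇⊆α∨β r)) )

      PreservesBooleanCenter : Set (lsuc ℓ)
      PreservesBooleanCenter = Surjective (_≈ᴮ_ Con) (_≈ᴮ_ L) lam-B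

module _ {S : Signature} where
  open Signature S

  CongruenceModular : ∀ ℓ {e} → Variety S e → Set (lsuc ℓ ⊔ e)
  CongruenceModular ℓ 𝒱 = (B : Algebra S ℓ) → B ∈ⱽ 𝒱 → Modular (Congruences.Con B)

  -- Contrapositive form: an algebra in 𝒱 with a one-element subalgebra {b}
  -- is trivial.
  Semidegenerate : ∀ ℓ {e} → Variety S e → Set (lsuc ℓ ⊔ e)
  Semidegenerate ℓ 𝒱 = (B : Algebra S ℓ) → B ∈ⱽ 𝒱 →
    (b : Algebra.Carrier B) → Congruences.IsSubuniverse B (λ x → Algebra._≈_ B x b) →
    Congruences.IsTrivial B

  Quotient : ∀ {ℓ} (A : Algebra S ℓ) → Congruences.Congruence A ℓ → Algebra S ℓ
  Quotient A θ = record
    { Carrier       = Algebra.Carrier A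
    ; _≈_           = Congruences.rel θ
    ; isEquivalence = record
      { refl  = θ.reflexive (IsEquivalence.refl (Algebra.isEquivalence A))
      ; sym   = θ.sym
      ; trans = θ.trans }
    ; op            = Algebra.op A
    ; op-cong       = θ.compat
    ; point         = Algebra.point A }
    where module θ = Congruences.Congruence θ

  private
    Quotient-eval : ∀ {ℓ} (A : Algebra S ℓ) (θ : Congruences.Congruence A ℓ)
                    {X : Set} (ρ : X → Algebra.Carrier A) (t : Term S X) →
                    Congruences.rel θ (Algebra.eval (Quotient A θ) ρ t) (Algebra.eval A ρ t)
    Quotient-eval A θ ρ (var x)     = IsEquivalence.refl (Algebra.isEquivalence (Quotient A θ))
    Quotient-eval A θ ρ (node f ts) =
      Algebra.op-cong (Quotient A θ) f (λ i → Quotient-eval A θ ρ (ts i))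

  Quotient-∈ⱽ : ∀ {ℓ e} (𝒱 : Variety S e) (A : Algebra S ℓ) (θ : Congruences.Congruence A ℓ) →
                A ∈ⱽ 𝒱 → Quotient A θ ∈ⱽ 𝒱
  Quotient-∈ⱽ 𝒱 A θ A∈𝒱 s t e ρ =
    θ.trans (Quotient-eval A θ ρ s)
      (θ.trans (θ.reflexive (A∈𝒱 s t e ρ)) (θ.sym (Quotient-eval A θ ρ t)))
    where module θ = Congruences.Congruence θ

  semidegenerate⇒∇-compact : ∀ {ℓ e} (𝒱 : Variety S e) → Semidegenerate ℓ 𝒱 →
    (A : Algebra S ℓ) → A ∈ⱽ 𝒱 → Congruences.Compact A (Congruences.∇ A)
  semidegenerate⇒∇-compact 𝒱 sd A A∈𝒱 θ ∇⊆⋁θ =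
    let (is , p) = finitely-many θ #ops
                     (λ f → ⋁-finitary θ (∇⊆⋁θ {op f (λ _ → point)} {point} tt))
        η        = ⋁-fin θ is
        module η = Congruence η
    in is , λ _ → sd (Quotient A η) (Quotient-∈ⱽ 𝒱 A η A∈𝒱) point
              (λ f as h → η.trans (η.compat f h) (p f)) _ _
    where
      open Algebra A
      open Congruences A

{-# OPTIONS --safe #-}

-- If λ(α) and λ(β) are complements in L(A), every prime contains exactly one
-- of α and β, so D(α) is clopen and hence equals D(γ) for some complemented
-- congruence γ.  Then γ and α lie below the same primes, i.e. λ(γ) = λ(α).
module Submission where

open import Defs
open import Data.Empty using (⊥-elim)
open import Data.Product.Base using (_×_; _,_; proj₁; proj₂)
open import Data.Sum.Base using (_⊎_; inj₁; inj₂; [_,_])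
open import Level using (Level) renaming (suc to lsuc)
open import Relation.Binary.Core using (_⇔_)
open import Relation.Nullary.Decidable.Core using (Dec; yes; no)
open import Relation.Nullary.Negation.Core using (¬_)
open import Relation.Unary using (_≐_)

module _ {S : Signature} {ℓ : Level} (A : Algebra S ℓ) where
  open Congruences A

  -- The common consequence of being complements in `Con` and in `L`. The disjunction is data, so it
  -- decides which of the two a prime contains.
  SpecComplements : Congruence ℓ → Congruence ℓ → Set (lsuc ℓ)
  SpecComplements α β = ∀ φ → (V α φ ⊎ V β φ) × ¬ (V α φ × V β φ)

  module _ (α β : Congruence ℓ) where

    specComplements : (∀ φ → V [ α ⨾ β ] φ) → (∀ φ → D (α ∨ β) φ) → SpecComplements α β
    specComplements meet join φ =
      IsPrime.prime (proj₂ φ) α β (meet φ) ,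
      λ (p , q) → join φ (∨-least α β (proj₁ φ) p q)

    -- The commutator lies below the meet, hence in every prime; the join is `∇`, which no prime
    -- contains.
    isComplement⇒specComplements : IsComplement Con α β → SpecComplements α β
    isComplement⇒specComplements ((α∧β⊆Δ , _) , (_ , ∇⊆α∨β)) = specComplements
      (λ φ r → Congruence.reflexive (proj₁ φ)
                 (α∧β⊆Δ (commutator-⊆ˡ α β r , commutator-⊆ʳ α β r)))
      (λ φ v → D-∇ φ (λ r → v (∇⊆α∨β r)))

    ρ-isComplement⇒specComplements :
      rel (ρ [ α ⨾ β ]) ⇔ rel (ρ Δ) → rel (ρ (α ∨ β)) ⇔ rel (ρ ∇) → SpecComplements α β
    ρ-isComplement⇒specComplements (ρ[α,β]⊆ρΔ , _) (_ , ρ∇⊆ρ[α∨β]) = specComplements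
      -- Here `λ ψ w → w r` is the inclusion of a congruence in its radical; the radical of `Δ` lies
      -- in every prime.
      (λ φ r → ρ[α,β]⊆ρΔ (λ ψ w → w r) φ (Congruence.reflexive (proj₁ φ)))
      (λ φ v → D-∇ φ (λ r → ρ∇⊆ρ[α∨β] (λ ψ w → w r) φ v))

    module _ (comp : SpecComplements α β) where

      V-dec : ∀ φ → Dec (V α φ)
      V-dec φ with comp φ
      ... | inj₁ p , _    = yes p
      ... | inj₂ q , excl = no (λ p → excl (p , q))

      V-stable : ∀ φ → ¬ D α φ → V α φ
      V-stable φ n with V-dec φ
      ... | yes p = p
      ... | no ¬p = ⊥-elim (n ¬p)

      specComplements⇒clopen : IsClopen (D α)
      specComplements⇒clopen = record
        { isOpen    = α , (λ d → d) , (λ d → d)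
        -- Exclusivity puts the complement of `D α` inside `D β`; the dichotomy gives the converse.
        ; isClosed  = β , (λ {φ} n q → n (λ p → proj₂ (comp φ) (p , q)))
                        , (λ {φ} ¬q d → [ d , ¬q ] (proj₁ (comp φ)))
        ; decidable = D-dec }
        where
          D-dec : ∀ φ → Dec (D α φ)
          D-dec φ with V-dec φ
          ... | yes p = no (λ d → d p)
          ... | no ¬p = yes ¬p

  -- As `D` is the negation of `V`, equality of the open sets compares the `V`s only up to double
  -- negation, which stability removes.
  D-injective-ρ : ∀ α β → (∀ φ → ¬ D α φ → V α φ) → (∀ φ → ¬ D β φ → V β φ) →
                  D α ≐ D β → rel (ρ α) ⇔ rel (ρ β)
  D-injective-ρ α β α-stable β-stable (Dα⊆Dβ , Dβ⊆Dα) =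
    (λ r φ v → r φ (α-stable φ (λ d → Dα⊆Dβ {φ} d v))) ,
    (λ r φ v → r φ (β-stable φ (λ d → Dβ⊆Dα {φ} d v)))

theorem4p11 : {ℓ e : Level} (S : Signature) (𝒱 : Variety S e)
    (sd : Semidegenerate ℓ 𝒱) (cm : CongruenceModular ℓ 𝒱)
    (A : Algebra S ℓ) (A∈𝒱 : A ∈ⱽ 𝒱) →
    let open Congruences A in
    (closed : CommutatorClosed) →
    IsBooleanIsomorphism Con Clop D-map →
    Reticulation.PreservesBooleanCenter (semidegenerate⇒∇-compact 𝒱 sd A A∈𝒱) closed (cm A A∈𝒱)
theorem4p11 S 𝒱 sd cm A A∈𝒱 closed iso ((α , _) , (β , _) , meet , join) =
  let comp    = ρ-isComplement⇒specComplements A α β meet join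
      (x , h) = proj₂ (IsBooleanIsomorphism.bijective iso)
                  (Congruences.D A α , specComplements⇒clopen A α β comp)
  in x , λ { {γ , γ′ , c} z≈x →
       D-injective-ρ A γ α
         (V-stable A γ γ′ (isComplement⇒specComplements A γ γ′ c))
         (V-stable A α β comp)
         (h {γ , γ′ , c} z≈x) }
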